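{- Let $n\ge 3$ be an integer and let $W_n$ be the wheel graph with $n$ rim vertices. Then $\mathrm{mpd}(W_n)=\infty$.
   Context: The wheel graph $W_n$ is obtained from a cycle on $n$ vertices (the rim) by adding one new vertex (the hub) adjacent to all rim vertices. $d(u,v)$ denotes the shortest-path distance. Let $G$ be a connected graph and let $\Pi=\{S_1,\dots,S_t\}$ be a partition of $V(G)$ into nonempty parts. For $v\in V(G)$ put $d(v,S_i)=\min\{d(v,x):x\in S_i\}$. The multiset partition representation of $v$ with respect to $\Pi$ is the multiset $r_{mp}(v\mid\Pi)=\{d(v,S_1),\dots,d(v,S_t)\}$ (order ignored, multiplicities kept). $\Pi$ is a resolving multiset partition if $r_{mp}(u\mid\Pi)\ne r_{mp}(v\mid\Pi)$ for all distinct $u,v\in V(G)$. The multiset partition dimension $\mathrm{mpd}(G)$ is the minimum number $t$ of parts of a resolving multiset partition of $G$, and $\mathrm{mpd}(G)=\infty$ if none exists. -}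

module Defs where

open import Data.Empty using (⊥)
open import Data.Fin using (Fin; zero; suc; toℕ; _≟_)
open import Data.Fin.Properties using (any?)
open import Data.List using (List; tabulate)
open import Data.List.Relation.Binary.Permutation.Propositional using (_↭_)
open import Data.Nat using (ℕ; zero; suc; _≤_; z≤n; s≤s)
import Data.Nat as ℕ
open import Data.Nat.Properties using (1+n≢n)
open import Data.Product using (Σ; ∃; _×_; _,_; proj₁; proj₂)
open import Data.Sum using (_⊎_; inj₁; inj₂; swap)
open import Data.Unit using (⊤; tt)
open import Function using (_∘_)
open import Function.Definitions using (StrictlySurjective)
open import Level using (0ℓ)
open import Relation.Binary using (Rel; Irreflexive; Symmetric)
import Relation.Binary as B
open import Relation.Binary.PropositionalEquality
  using (_≡_; _≢_; refl; sym)
open import Relation.Nullary using (¬_; yes; no; contradiction)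
open import Relation.Nullary.Construct.Add.Supremum using (_⁺; [_]; ⊤⁺)
open import Relation.Nullary.Decidable using (_×-dec_; _⊎-dec_)
import Relation.Unary as U

-- Minimum of a decidable set of naturals with a known element k.  The
-- value does not depend on k, by least-∈ and least-≤.
least : {P : U.Pred ℕ 0ℓ} → U.Decidable P → ∀ k → P k → ℕ
least P? zero    _ = 0
least P? (suc k) p with P? 0
... | yes _ = 0
... | no  _ = suc (least (P? ∘ suc) k p)

least-∈ : {P : U.Pred ℕ 0ℓ} (P? : U.Decidable P) → ∀ k (p : P k) →
          P (least P? k p)
least-∈ P? zero    p = p
least-∈ P? (suc k) p with P? 0
... | yes p₀ = p₀
... | no  _  = least-∈ (P? ∘ suc) k p

least-≤ : {P : U.Pred ℕ 0ℓ} (P? : U.Decidable P) → ∀ k (p : P k) →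
          ∀ {m} → P m → least P? k p ≤ m
least-≤ P? zero    _ _ = z≤n
least-≤ P? (suc k) p {m} q with P? 0
least-≤ P? (suc k) p {m}     q | yes _  = z≤n
least-≤ P? (suc k) p {zero}  q | no ¬p₀ = contradiction q ¬p₀
least-≤ P? (suc k) p {suc m} q | no _   = s≤s (least-≤ (P? ∘ suc) k p q)

-- Finite simple graphs.
record Graph : Set₁ where
  infix 4 _~_ _~?_
  field
    order    : ℕ
    _~_      : Rel (Fin order) 0ℓ
    _~?_     : B.Decidable _~_
    ~-sym    : Symmetric _~_
    ~-irrefl : Irreflexive _≡_ _~_

  Vertex : Set
  Vertex = Fin order

  Walk : ℕ → Rel Vertex 0ℓ
  Walk zero    u v = u ≡ v
  Walk (suc k) u v = ∃ λ w → u ~ w × Walk k w v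

  walk? : ∀ k → B.Decidable (Walk k)
  walk? zero    u v = u ≟ v
  walk? (suc k) u v = any? λ w → (u ~? w) ×-dec walk? k w v

  Connected : Set
  Connected = ∀ u v → ∃ λ k → Walk k u v

record ConnectedGraph : Set₁ where
  field
    graph     : Graph
    connected : Graph.Connected graph

  open Graph graph public

  -- A walk of minimum length is a path, so this is the length of a
  -- shortest path.
  d : Vertex → Vertex → ℕ
  d u v = least (λ k → walk? k u v) (proj₁ (connected u v)) (proj₂ (connected u v))

module _ (G : ConnectedGraph) where
  open ConnectedGraph G

  -- A partition into t nonempty parts, given by the map sending a vertex
  -- to the index of its part: Sᵢ is the fibre over i.  The numbering of
  -- the parts is immaterial, since representations are compared up to
  -- permutation.
  record Partition (t : ℕ) : Set where
    field
      part     : Vertex → Fin t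
      nonempty : StrictlySurjective _≡_ part

    -- d(v, Sᵢ) = min { d(v, x) : x ∈ Sᵢ }
    dPart : Vertex → Fin t → ℕ
    dPart v i = least {P = λ k → ∃ λ x → part x ≡ i × d v x ≡ k}
      (λ k → any? λ x → (part x ≟ i) ×-dec (d v x ℕ.≟ k))
      (d v (proj₁ (nonempty i)))
      (proj₁ (nonempty i) , proj₂ (nonempty i) , refl)

    -- A multiset is a list, with _↭_ as equality.
    rmp : Vertex → List ℕ
    rmp v = tabulate (dPart v)

    Resolving : Set
    Resolving = ∀ {u v} → u ≢ v → ¬ (rmp u ↭ rmp v)

  HasResolvingPartition : ℕ → Set
  HasResolvingPartition t = Σ (Partition t) Partition.Resolving

  -- IsMpd x means mpd(G) = x, where ⊤⁺ is ∞.
  IsMpd : ℕ ⁺ → Set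
  IsMpd [ t ] = HasResolvingPartition t ×
                (∀ s → HasResolvingPartition s → t ≤ s)
  IsMpd ⊤⁺    = ¬ ∃ HasResolvingPartition

-- The cyclic successor relation on Fin n.
Next : ∀ {n} → Rel (Fin n) 0ℓ
Next {n} i j = toℕ j ≡ suc (toℕ i) ⊎ (suc (toℕ i) ≡ n × toℕ j ≡ 0)

next? : ∀ {n} → B.Decidable (Next {n})
next? {n} i j =
  (toℕ j ℕ.≟ suc (toℕ i)) ⊎-dec ((suc (toℕ i) ℕ.≟ n) ×-dec (toℕ j ℕ.≟ 0))

next-irrefl : ∀ {n} → 3 ≤ n → (i : Fin n) → ¬ Next i i
next-irrefl n≥3              i       (inj₁ eq)       = 1+n≢n (sym eq)
next-irrefl (s≤s (s≤s n≥1))  zero    (inj₂ (() , _))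
next-irrefl n≥3              (suc i) (inj₂ (_ , ()))

cycle : ∀ n → 3 ≤ n → Graph
cycle n n≥3 = record
  { order    = n
  ; _~_      = λ i j → Next i j ⊎ Next j i
  ; _~?_     = λ i j → next? i j ⊎-dec next? j i
  ; ~-sym    = swap
  ; ~-irrefl = λ { {i} refl (inj₁ p) → next-irrefl n≥3 i p
                 ; {i} refl (inj₂ p) → next-irrefl n≥3 i p }
  }

-- Adds one new vertex (zero) adjacent to all vertices of G; the vertex v
-- of G becomes suc v.
module _ (G : Graph) where
  open Graph G

  HubAdj : Rel (Fin (suc order)) 0ℓ
  HubAdj zero    zero    = ⊥
  HubAdj zero    (suc _) = ⊤
  HubAdj (suc _) zero    = ⊤
  HubAdj (suc u) (suc v) = u ~ v

  hubAdj? : B.Decidable HubAdj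
  hubAdj? zero    zero    = no λ ()
  hubAdj? zero    (suc _) = yes tt
  hubAdj? (suc _) zero    = yes tt
  hubAdj? (suc u) (suc v) = u ~? v

  hubAdj-sym : Symmetric HubAdj
  hubAdj-sym {zero}  {suc _} _ = tt
  hubAdj-sym {suc _} {zero}  _ = tt
  hubAdj-sym {suc _} {suc _} p = ~-sym p

  hubAdj-irrefl : Irreflexive _≡_ HubAdj
  hubAdj-irrefl {suc _} refl p = ~-irrefl refl p

  addHub : Graph
  addHub = record
    { order    = suc order
    ; _~_      = HubAdj
    ; _~?_     = hubAdj?
    ; ~-sym    = λ {u} {v} → hubAdj-sym {u} {v}
    ; ~-irrefl = λ {u} {v} → hubAdj-irrefl {u} {v}
    }

  addHub-connected : Graph.Connected addHub
  addHub-connected zero    zero    = 0 , refl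
  addHub-connected zero    (suc v) = 1 , suc v , tt , refl
  addHub-connected (suc u) zero    = 1 , zero , tt , refl
  addHub-connected (suc u) (suc v) = 2 , zero , tt , suc v , tt , refl

wheel : ∀ n → 3 ≤ n → ConnectedGraph
wheel n n≥3 = record
  { graph     = addHub (cycle n n≥3)
  ; connected = addHub-connected (cycle n n≥3)
  }

{-# OPTIONS --safe #-}

-- Distances in a wheel are at most 2, so the representation of a vertex v
-- consists of one 0, some 1s and some 2s; it is determined by the number c(v)
-- of parts at distance at most 1 from v, that is, of parts meeting the closed
-- neighbourhood N[v].  For a rim vertex, N[v] has at most four elements, so
-- 1 ≤ c(v) ≤ 4, and c cannot be injective on the rim if n ≥ 5.  If n = 4, the
-- values 4 and 1 do not both occur: if c(w) = 1 then N[w] lies in the part of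
-- the hub, and since N[w] and N[v] share a rim vertex, c(v) ≤ 3.  So again
-- two rim vertices have the same c.  If n = 3, then N[v] is everything.
module Submission where

open import Defs
open import Data.Fin using (Fin; zero; suc; toℕ; fromℕ<)
import Data.Fin as Fin
open import Data.Fin.Properties
  using (all?; any?; pigeonhole; fromℕ<-injective; toℕ-injective; toℕ<n)
import Data.Fin.Properties as Fin
open import Data.List using (List; []; _∷_; _++_; length; map; filter; replicate; tabulate; allFin)
open import Data.List.Membership.Propositional using (_∈_)
open import Data.List.Membership.Propositional.Properties
  using (∈-filter⁺; ∈-filter⁻; ∈-allFin; ∈-∃++; ∈-map⁺)
open import Data.List.Properties
  using (map-++; map-tabulate; length-++; length-tabulate; filter-notAll; partition-defn)
open import Data.List.Relation.Binary.Permutation.Propositional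
  using (_↭_; ↭-sym; ↭-trans; ↭-reflexive; ↭⇒↭ₛ; ↭ₛ⇒↭; module PermutationReasoning)
open import Data.List.Relation.Binary.Permutation.Propositional.Properties
  using (map⁺; ++⁺ʳ; shift; ↭-length)
import Data.List.Relation.Binary.Permutation.Setoid as ↭
import Data.List.Relation.Binary.Permutation.Setoid.Properties as ↭ₛ
open import Data.List.Relation.Binary.Subset.Propositional using (_⊆_)
open import Data.List.Relation.Unary.All using (All; []; _∷_)
import Data.List.Relation.Unary.All as All
open import Data.List.Relation.Unary.All.Properties using (all-filter)
open import Data.List.Relation.Unary.AllPairs using ([]; _∷_)
open import Data.List.Relation.Unary.Any using (here; there)
import Data.List.Relation.Unary.Any as Any
open import Data.List.Relation.Unary.Unique.Propositional using (Unique)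
import Data.List.Relation.Unary.Unique.Propositional.Properties as Unique
open import Data.Nat using (ℕ; zero; suc; _+_; _∸_; _≤_; _<_; _≤?_; z≤n; s≤s)
import Data.Nat as ℕ
open import Data.Nat.Properties
  using (≤-refl; ≤-trans; ≤-antisym; ≤∧≢⇒<; n≤0⇒n≡0; ≰⇒>; <⇒≢; suc-injective;
         ∸-cancelʳ-≡; ∸-monoˡ-<; m+n∸m≡n; 0≢1+n; 1+n≰n)
open import Data.Product using (∃; ∃₂; _×_; _,_; proj₁; proj₂)
open import Data.Sum using (_⊎_; inj₁; inj₂; [_,_]′)
open import Function using (_∘_; id)
open import Level using (Level)
open import Relation.Binary using (DecidableEquality; Decidable)
open import Relation.Binary.PropositionalEquality
  using (_≡_; _≢_; refl; sym; trans; cong; cong₂; subst; ≢-sym; setoid; resp₂)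
open import Relation.Nullary using (¬_; yes; no; contradiction)
open import Relation.Nullary.Construct.Add.Supremum using (⊤⁺)
open import Relation.Nullary.Decidable using (from-yes; toSum; ¬?; _×-dec_; _⊎-dec_)
import Relation.Unary as U
open import Relation.Unary.Properties using (∁?)

-- Counting with lists and normal forms of multisets

private
  variable
    a b p : Level
    A : Set a
    B : Set b

-- Subtracting `lo` sends the values into `Fin m`, and truncated subtraction is injective on numbers
-- that are at least `lo`.
pigeonhole-interval : ∀ {m n} lo (f : Fin n → ℕ) → m < n →
                      (∀ i → lo ≤ f i) → (∀ i → f i < lo + m) →
                      ∃₂ λ i j → i ≢ j × f i ≡ f j
pigeonhole-interval {m} lo f m<n lo≤f f<hi =
  let i , j , i<j , eq = pigeonhole m<n (λ i → fromℕ< (offset<m i))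
  in i , j , Fin.<⇒≢ i<j , ∸-cancelʳ-≡ (lo≤f i) (lo≤f j) (fromℕ<-injective _ _ _ _ eq)
  where
  offset<m : ∀ i → f i ∸ lo < m
  offset<m i = subst (f i ∸ lo <_) (m+n∸m≡n lo m) (∸-monoˡ-< (f<hi i) (lo≤f i))

-- Induction on `xs`: deleting the head `x` from `ys` shortens `ys`, and the tail, being free of
-- `x`, still lies in what remains.
length-mono-⊆ : DecidableEquality A → ∀ {xs ys : List A} →
                Unique xs → xs ⊆ ys → length xs ≤ length ys
length-mono-⊆ _≟_ {[]}              _            _     = z≤n
length-mono-⊆ _≟_ {x ∷ xs} {ys} (x∉xs ∷ xs!) xs⊆ys = ≤-trans
  (s≤s (length-mono-⊆ _≟_ xs! λ y∈xs →
    ∈-filter⁺ ≢x? (xs⊆ys (there y∈xs)) (≢-sym (All.lookup x∉xs y∈xs))))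
  (filter-notAll ≢x? ys (Any.map (λ x≡y y≢x → y≢x (sym x≡y)) (xs⊆ys (here refl))))
  where
  ≢x? : U.Decidable (_≢ x)
  ≢x? y = ¬? (y ≟ x)

length≡1⇒≡ : ∀ {xs : List A} {x y} → length xs ≡ 1 → x ∈ xs → y ∈ xs → x ≡ y
length≡1⇒≡ {xs = _ ∷ []} _ (here refl) (here refl) = refl

map≡replicate : ∀ {f : A → B} {c xs} → All (λ x → f x ≡ c) xs →
                map f xs ≡ replicate (length xs) c
map≡replicate []       = refl
map≡replicate (e ∷ es) = cong₂ _∷_ e (map≡replicate es)

filter-↭ : ∀ {P : U.Pred A p} (P? : U.Decidable P) xs →
           xs ↭ filter P? xs ++ filter (∁? P?) xs
filter-↭ P? xs = ↭ₛ⇒↭ (subst (λ (ys , zs) → xs ↭ₛ ys ++ zs) (partition-defn P? xs)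
                              (↭ₛ.partition-↭ (setoid _) P? xs))
  where open ↭ (setoid _) using () renaming (_↭_ to _↭ₛ_)

-- Uniqueness is invariant under permutation, so once `x` is moved to the front it is absent from
-- the rest.
∈-unique-↭ : ∀ {x : A} {xs} → Unique xs → x ∈ xs →
             ∃ λ ys → xs ↭ x ∷ ys × All (x ≢_) ys
∈-unique-↭ {x = x} xs! x∈xs with ys , zs , refl ← ∈-∃++ x∈xs
  with x∉ ∷ _ ← ↭ₛ.AllPairs-resp-↭ (setoid _) ≢-sym (resp₂ _) (↭⇒↭ₛ (shift x ys zs)) xs!
  = ys ++ zs , shift x ys zs , x∉

-- c counts the entries at most 1, including the leading 0.
canonical : ℕ → ℕ → List ℕ
canonical t c = 0 ∷ replicate (c ∸ 1) 1 ++ replicate (t ∸ c) 2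

near : ∀ {t} → (Fin t → ℕ) → List (Fin t)
near f = filter (λ i → f i ≤? 1) (allFin _)

-- The indices split into near and far ones. Far entries lie between 2 and 2; near entries other
-- than the one at `i` are at most 1 and nonzero.
tabulate-↭-canonical : ∀ {t} {f : Fin t → ℕ} {i} → f i ≡ 0 →
                       (∀ {j} → f j ≡ 0 → i ≡ j) → (∀ j → f j ≤ 2) →
                       tabulate f ↭ canonical t (length (near f))
tabulate-↭-canonical {t} {f} {i} fi≡0 zero-unique f≤2
  with ys , near↭ , i∉ys ← ∈-unique-↭ {x = i} {near f} (Unique.filter⁺ (λ i → f i ≤? 1) (Unique.allFin⁺ t))
         (∈-filter⁺ (λ i → f i ≤? 1) (∈-allFin i) (subst (_≤ 1) (sym fi≡0) z≤n))
  = begin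
  tabulate f                         ≡⟨ map-tabulate id f ⟨
  map f (allFin t)                   ↭⟨ map⁺ f allFin↭ ⟩
  map f (near f ++ far)              ↭⟨ map⁺ f (++⁺ʳ far near↭) ⟩
  map f (i ∷ ys ++ far)              ≡⟨ cong₂ _∷_ fi≡0 (map-++ f ys far) ⟩
  0 ∷ map f ys ++ map f far          ≡⟨ cong (0 ∷_) (cong₂ _++_ (map≡replicate ys≡1) (map≡replicate far≡2)) ⟩
  0 ∷ replicate (length ys) 1 ++ replicate (length far) 2
    -- `length (i ∷ ys) ∸ 1` computes to `length ys`; the subtracted 1 accounts for the entry 0 at
    -- `i`.
    ≡⟨ cong (0 ∷_) (cong₂ (λ k l → replicate k 1 ++ replicate l 2)
                          (cong (_∸ 1) (sym (↭-length near↭))) length-far) ⟩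
  canonical t (length (near f))      ∎
  where
  open PermutationReasoning
  far : List (Fin t)
  far = filter (∁? λ i → f i ≤? 1) (allFin t)
  allFin↭ : allFin t ↭ near f ++ far
  allFin↭ = filter-↭ (λ i → f i ≤? 1) (allFin t)
  length-far : length far ≡ t ∸ length (near f)
  length-far = trans (sym (m+n∸m≡n (length (near f)) _)) (cong (_∸ length (near f))
    (trans (sym (length-++ (near f))) (trans (sym (↭-length allFin↭)) (length-tabulate id))))
  far≡2 : All (λ j → f j ≡ 2) far
  far≡2 = All.map (λ {j} f≰1 → ≤-antisym (f≤2 j) (≰⇒> f≰1)) (all-filter (∁? λ i → f i ≤? 1) (allFin t))
  ys≡1 : All (λ j → f j ≡ 1) ys
  ys≡1 = All.tabulate λ {j} j∈ys → ≤-antisym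
    (All.lookup (all-filter (λ i → f i ≤? 1) (allFin t))
                (↭ₛ.∈-resp-↭ (setoid _) (↭⇒↭ₛ (↭-sym near↭)) (there j∈ys)))
    (≤∧≢⇒< z≤n (λ 0≡fj → All.lookup i∉ys j∈ys (zero-unique (sym 0≡fj))))

-- Closed neighbourhoods and graphs of diameter at most 2

module _ (G : ConnectedGraph) where
  open ConnectedGraph G

  infix 4 _≃_
  -- Membership of `v` in the closed neighbourhood N[u].
  _≃_ : Vertex → Vertex → Set
  u ≃ v = u ≡ v ⊎ u ~ v

  _≃?_ : Decidable _≃_
  u ≃? v = (u Fin.≟ v) ⊎-dec (u ~? v)

  d-least : ∀ {k} u v → Walk k u v → d u v ≤ k
  d-least u v = least-≤ (λ k → walk? k u v) (proj₁ (connected u v)) (proj₂ (connected u v))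

  d-walk : ∀ u v → Walk (d u v) u v
  d-walk u v = least-∈ (λ k → walk? k u v) (proj₁ (connected u v)) (proj₂ (connected u v))

  d≤1⇒≃ : ∀ u v → d u v ≤ 1 → u ≃ v
  d≤1⇒≃ u v d≤1 with d u v | d-walk u v
  ... | 0 | refl           = inj₁ refl
  ... | 1 | _ , p , refl   = inj₂ p
  d≤1⇒≃ u v (s≤s ()) | suc (suc _) | _

  ≃⇒d≤1 : ∀ u v → u ≃ v → d u v ≤ 1
  ≃⇒d≤1 u v (inj₁ u≡v) = ≤-trans (d-least {0} u v u≡v) z≤n
  ≃⇒d≤1 u v (inj₂ u~v) = d-least u v (v , u~v , refl)

  module _ {t} (Π : Partition G t) where
    open Partition Π

    dPart-least : ∀ v x → dPart v (part x) ≤ d v x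
    dPart-least v x = least-≤ (λ k → any? λ y → (part y Fin.≟ part x) ×-dec (d v y ℕ.≟ k))
      (d v (proj₁ (nonempty (part x)))) (proj₁ (nonempty (part x)) , proj₂ (nonempty (part x)) , refl)
      (x , refl , refl)

    dPart-attained : ∀ v i → ∃ λ x → part x ≡ i × d v x ≡ dPart v i
    dPart-attained v i = least-∈ (λ k → any? λ x → (part x Fin.≟ i) ×-dec (d v x ℕ.≟ k))
      (d v (proj₁ (nonempty i))) (proj₁ (nonempty i) , proj₂ (nonempty i) , refl)

    -- The parts meeting N[v]; the length of this list is c(v).
    nearParts : Vertex → List (Fin t)
    nearParts v = near (dPart v)

    nearParts! : ∀ v → Unique (nearParts v)
    nearParts! v = Unique.filter⁺ (λ i → dPart v i ≤? 1) (Unique.allFin⁺ t)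

    ∈-nearParts⁺ : ∀ v x → v ≃ x → part x ∈ nearParts v
    ∈-nearParts⁺ v x v≃x = ∈-filter⁺ (λ i → dPart v i ≤? 1) (∈-allFin (part x))
      (≤-trans (dPart-least v x) (≃⇒d≤1 v x v≃x))

    ∈-nearParts⁻ : ∀ v {i} → i ∈ nearParts v → ∃ λ x → v ≃ x × part x ≡ i
    ∈-nearParts⁻ v {i} i∈
      with _ , d≤1 ← ∈-filter⁻ (λ i → dPart v i ≤? 1) {xs = allFin t} i∈
      with x , eq , dx ← dPart-attained v i
      = x , d≤1⇒≃ v x (subst (_≤ 1) (sym dx) d≤1) , eq

    -- The source of all upper bounds on c(v): `is` may repeat parts, while `nearParts v` does not.
    ∣nearParts∣≤ : ∀ v is → (∀ x → v ≃ x → part x ∈ is) → length (nearParts v) ≤ length is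
    ∣nearParts∣≤ v is parts∈ = length-mono-⊆ Fin._≟_ (nearParts! v) λ i∈ →
      let x , v≃x , eq = ∈-nearParts⁻ v i∈ in subst (_∈ is) eq (parts∈ x v≃x)

    1≤∣nearParts∣ : ∀ v → 1 ≤ length (nearParts v)
    1≤∣nearParts∣ v = length-mono-⊆ Fin._≟_ {part v ∷ []} ([] ∷ [])
      λ { (here refl) → ∈-nearParts⁺ v v (inj₁ refl) }

    module _ (d≤2 : ∀ u v → d u v ≤ 2) where

      rmp-↭-canonical : ∀ v → rmp v ↭ canonical t (length (nearParts v))
      rmp-↭-canonical v = tabulate-↭-canonical
        (n≤0⇒n≡0 (≤-trans (dPart-least v v) (d-least v v refl)))
        own
        (λ i → let x , _ , dx = dPart-attained v i in subst (_≤ 2) dx (d≤2 v x))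
        where
        -- A walk of length 0 is an equality, so a part at distance 0 contains `v` itself.
        own : ∀ {i} → dPart v i ≡ 0 → part v ≡ i
        own {i} eq with x , refl , dx ← dPart-attained v i =
          cong part (subst (λ k → Walk k v x) (trans dx eq) (d-walk v x))

      resolving⇒∣nearParts∣-injective : Resolving → ∀ {u v} → u ≢ v →
                                        length (nearParts u) ≢ length (nearParts v)
      resolving⇒∣nearParts∣-injective res {u} {v} u≢v eq = res u≢v
        (↭-trans (rmp-↭-canonical u)
          (↭-trans (↭-reflexive (cong (canonical t) eq)) (↭-sym (rmp-↭-canonical v))))

-- Neighbourhoods on the rim

Next-functional : ∀ {n} {i j k : Fin n} → Next i j → Next i k → j ≡ k
Next-functional (inj₁ p)       (inj₁ q)       = toℕ-injective (trans p (sym q))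
-- If `i` wraps around, an ordinary successor of `i` would have index `n`.
Next-functional {j = j} (inj₁ p) (inj₂ (e , _)) = contradiction (trans p e) (<⇒≢ (toℕ<n j))
Next-functional {k = k} (inj₂ (e , _)) (inj₁ q) = contradiction (trans q e) (<⇒≢ (toℕ<n k))
Next-functional (inj₂ (_ , p)) (inj₂ (_ , q)) = toℕ-injective (trans p (sym q))

Next-injective : ∀ {n} {i j k : Fin n} → Next j i → Next k i → j ≡ k
Next-injective (inj₁ p)       (inj₁ q)       = toℕ-injective (suc-injective (trans (sym p) q))
Next-injective (inj₁ p)       (inj₂ (_ , q)) = contradiction (trans (sym q) p) 0≢1+n
Next-injective (inj₂ (_ , p)) (inj₁ q)       = contradiction (trans (sym p) q) 0≢1+n
Next-injective (inj₂ (p , _)) (inj₂ (q , _)) = toℕ-injective (suc-injective (trans p (sym q)))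

-- If P is empty, the default element serves as a junk value.
subsingleton-bound : ∀ {n} {P : U.Pred (Fin n) p} → U.Decidable P → Fin n →
                     (∀ {j k} → P j → P k → j ≡ k) → ∃ λ j → ∀ {k} → P k → k ≡ j
subsingleton-bound P? default P-unique with any? P?
... | yes (j , pj) = j , λ pk → P-unique pk pj
... | no ¬∃P       = default , λ pk → contradiction (_ , pk) ¬∃P

module _ {n} (n≥3 : 3 ≤ n) where
  open ConnectedGraph (wheel n n≥3) using (d)

  infix 4 _≃ʷ_
  _≃ʷ_ : Fin (suc n) → Fin (suc n) → Set
  _≃ʷ_ = _≃_ (wheel n n≥3)

  next-bound : (v : Fin n) → ∃ λ j → ∀ {x} → Next v x → x ≡ j
  next-bound v = subsingleton-bound (next? v) v Next-functional

  prev-bound : (v : Fin n) → ∃ λ j → ∀ {x} → Next x v → x ≡ j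
  prev-bound v = subsingleton-bound (λ j → next? j v) v Next-injective

  -- Three candidates covering the rim vertices of N[v]; upper bounds on c(v) rely on this inclusion
  -- alone.
  rimNbhd : Fin n → List (Fin n)
  rimNbhd v = v ∷ proj₁ (next-bound v) ∷ proj₁ (prev-bound v) ∷ []

  ∈-rimNbhd : ∀ {v x : Fin n} → suc v ≃ʷ suc x → x ∈ rimNbhd v
  ∈-rimNbhd     (inj₁ refl)     = here refl
  ∈-rimNbhd {v} (inj₂ (inj₁ p)) = there (here (proj₂ (next-bound v) p))
  ∈-rimNbhd {v} (inj₂ (inj₂ p)) = there (there (here (proj₂ (prev-bound v) p)))

  wheel-d≤2 : ∀ u v → d u v ≤ 2
  wheel-d≤2 u v = ≤-trans
    (d-least (wheel n n≥3) u v (proj₂ (addHub-connected (cycle n n≥3) u v))) (length≤2 u v)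
    where
    length≤2 : ∀ u v → proj₁ (addHub-connected (cycle n n≥3) u v) ≤ 2
    length≤2 zero    zero    = z≤n
    length≤2 zero    (suc _) = s≤s z≤n
    length≤2 (suc _) zero    = s≤s z≤n
    length≤2 (suc _) (suc _) = ≤-refl

  module _ {t} (Π : Partition (wheel n n≥3) t) where
    open Partition Π using (part)

    rimParts : Fin n → List (Fin t)
    rimParts v = nearParts (wheel n n≥3) Π (suc v)

    ∣rimParts∣≤4 : ∀ v → length (rimParts v) ≤ 4
    ∣rimParts∣≤4 v = ∣nearParts∣≤ _ Π (suc v) (part zero ∷ map (part ∘ suc) (rimNbhd v))
      λ { zero    _   → here refl
        ; (suc x) v≃x → there (∈-map⁺ (part ∘ suc) (∈-rimNbhd v≃x)) }

    -- The part of the hub is already contributed by `x`, so the three rim candidates cover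
    -- everything.
    ∣rimParts∣≤3 : ∀ v x → suc v ≃ʷ suc x → part zero ≡ part (suc x) →
                   length (rimParts v) ≤ 3
    ∣rimParts∣≤3 v x v≃x eq = ∣nearParts∣≤ _ Π (suc v) (map (part ∘ suc) (rimNbhd v))
      λ { zero    _   → subst (_∈ map (part ∘ suc) (rimNbhd v)) (sym eq)
                              (∈-map⁺ (part ∘ suc) (∈-rimNbhd v≃x))
        ; (suc y) v≃y → ∈-map⁺ (part ∘ suc) (∈-rimNbhd v≃y) }

    -- The hub and `x` both lie in N[w], which meets a single part, so they share it.
    ∣rimParts∣≡1⇒≤3 : ∀ v w x → suc v ≃ʷ suc x → suc w ≃ʷ suc x →
                      length (rimParts w) ≡ 1 → length (rimParts v) ≤ 3
    ∣rimParts∣≡1⇒≤3 v w x v≃x w≃x eq = ∣rimParts∣≤3 v x v≃x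
      (length≡1⇒≡ eq (∈-nearParts⁺ _ Π (suc w) zero (inj₂ _)) (∈-nearParts⁺ _ Π (suc w) (suc x) w≃x))

    -- Here N[v] contains every vertex; exchanging `u` and `v` turns the inequality into equality.
    rimParts-full : (∀ v x → suc v ≃ʷ suc x) → ∀ u v → length (rimParts u) ≤ length (rimParts v)
    rimParts-full adj u v = ∣nearParts∣≤ _ Π (suc u) (rimParts v)
      λ { zero    _ → ∈-nearParts⁺ _ Π (suc v) zero (inj₂ _)
        ; (suc x) _ → ∈-nearParts⁺ _ Π (suc v) (suc x) (adj v x) }

-- Rim vertices with equal counts

RimCollision : ∀ n (n≥3 : 3 ≤ n) → Set
RimCollision n n≥3 = ∀ {t} (Π : Partition (wheel n n≥3) t) →
  ∃₂ λ u v → u ≢ v × length (rimParts n≥3 Π u) ≡ length (rimParts n≥3 Π v)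

collision₃ : ∀ n≥3 → RimCollision 3 n≥3
collision₃ n≥3 Π = zero , suc zero , (λ ()) ,
  ≤-antisym (rimParts-full n≥3 Π adj zero (suc zero)) (rimParts-full n≥3 Π adj (suc zero) zero)
  where
  adj : ∀ v x → _≃ʷ_ n≥3 (suc v) (suc x)
  adj = from-yes (all? λ v → all? λ x → _≃?_ (wheel 3 n≥3) (suc v) (suc x))

-- Two closed neighbourhoods of size 3 in a 4-cycle must overlap; the finitely many cases are
-- decided by evaluation.
common-neighbour₄ : ∀ n≥3 v w → ∃ λ (x : Fin 4) → _≃ʷ_ n≥3 (suc v) (suc x) × _≃ʷ_ n≥3 (suc w) (suc x)
common-neighbour₄ n≥3 = from-yes (all? λ v → all? λ w → any? λ x →
  _≃?_ (wheel 4 n≥3) (suc v) (suc x) ×-dec _≃?_ (wheel 4 n≥3) (suc w) (suc x))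

collision₄ : ∀ n≥3 → RimCollision 4 n≥3
collision₄ n≥3 Π = [ with-4 , without-4 ]′ (toSum (any? λ v → 4 ≤? c v))
  where
  c : Fin 4 → ℕ
  c v = length (rimParts n≥3 Π v)

  1≤c : ∀ v → 1 ≤ c v
  1≤c v = 1≤∣nearParts∣ _ Π (suc v)

  with-4 : (∃ λ v → 4 ≤ c v) → ∃₂ λ u v → u ≢ v × c u ≡ c v
  -- The value 1 is excluded, leaving 2, 3, 4 for four vertices; `≤-refl` fixes `m` as 3.
  with-4 (v , 4≤cv) = pigeonhole-interval 2 c ≤-refl
    (λ w → ≤∧≢⇒< (1≤c w) λ 1≡cw →
       let x , v≃x , w≃x = common-neighbour₄ n≥3 v w
       in 1+n≰n (≤-trans 4≤cv (∣rimParts∣≡1⇒≤3 n≥3 Π v w x v≃x w≃x (sym 1≡cw))))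
    (λ w → s≤s (∣rimParts∣≤4 n≥3 Π w))

  without-4 : ¬ (∃ λ v → 4 ≤ c v) → ∃₂ λ u v → u ≢ v × c u ≡ c v
  -- Now the values are 1, 2, 3, again three for four vertices.
  without-4 ∄4 = pigeonhole-interval 1 c ≤-refl 1≤c (λ v → ≰⇒> λ 4≤cv → ∄4 (v , 4≤cv))

collision₅₊ : ∀ {n} n≥3 → 5 ≤ n → RimCollision n n≥3
-- `n≥5` unfolds to `4 < n`, with the four values 1 to 4.
collision₅₊ n≥3 n≥5 Π = pigeonhole-interval 1 (length ∘ rimParts n≥3 Π) n≥5
  (λ v → 1≤∣nearParts∣ _ Π (suc v)) (λ v → s≤s (∣rimParts∣≤4 n≥3 Π v))

collision : ∀ n n≥3 → RimCollision n n≥3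
collision 3 n≥3 = collision₃ n≥3
collision 4 n≥3 = collision₄ n≥3
collision (suc (suc (suc (suc (suc n))))) n≥3 = collision₅₊ n≥3 (s≤s (s≤s (s≤s (s≤s (s≤s z≤n)))))
collision 1 (s≤s ())
collision 2 (s≤s (s≤s ()))

theorem4p2 : (n : ℕ) (n≥3 : 3 ≤ n) → IsMpd (wheel n n≥3) ⊤⁺
theorem4p2 n n≥3 (t , Π , res) with u , v , u≢v , eq ← collision n n≥3 Π =
  resolving⇒∣nearParts∣-injective _ Π (wheel-d≤2 n≥3) res (u≢v ∘ Fin.suc-injective) eq
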